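{- There is no $f$-competitive policy that minimizes the sum of adjusted response times in the online linear tape sequencing problem (online LTS), for any bounded function $f$. That is, for every bounded function $f$ of the instance and every online policy, there is an instance on which the sum of adjusted response times of the policy exceeds $f$ times the minimum sum of adjusted response times attainable offline.
   Context: Tape. A tape is a set of files $\mathscr F=\{1,\dots,n\}$ stored contiguously, in index order from left to right, on a line. File $i$ has size $s_i$ (a positive integer number of bits), left position $\ell_i$ and right position $r_i=\ell_i+s_i$, with $\ell_1=0$, $\ell_{i+1}=r_i$, and tape length $L=r_n=\sum_i s_i$. The tape head starts at position $L$ at time $0$ and moves at (at most) unit speed in either direction. A file is read by moving the head from $\ell_i$ to $r_i$ (left to right). Online LTS with adjusted response times. Requests for files become available over time: each request has a file and a release time, and an online policy learns of a request only at its release time. A request for file $i$ is serviced by a reading of $i$ that starts (head at $\ell_i$) at or after its release time. The adjusted response time of a request is the time at which the reading servicing it starts minus the release time of the request (e.g. a request released at time $7$ and serviced at time $10$ has adjusted response time $3$). The objective considered is the sum of the adjusted response times of all requests. The offline optimum is the minimum of this sum over all head movements that know all requests and release times in advance (but still service each request only at or after its release). -}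

module Defs where

open import Algebra.Apartness.Bundles using (HeytingField)
open import Algebra.Bundles using (RawMonoid)
open import Algebra.Core using (Op₂)
import Algebra.Definitions.RawMonoid as MonoidDefinitions
open import Data.Fin.Base using (Fin; zero; suc)
open import Data.List.Base using (List; _++_; length; lookup)
open import Data.List.Relation.Unary.All using (All)
open import Data.List.Relation.Unary.Linked using (Linked)
open import Data.Nat.Base as ℕ using (ℕ; NonZero)
open import Data.Product.Base using (∃; ∃₂; _×_)
open import Data.Sum.Base using (_⊎_)
open import Data.Vec.Functional using (Vector; head; tail; foldr)
open import Function.Bundles using (_⇔_)
open import Level using (Level) renaming (_⊔_ to _⊔ˡ_; suc to lsuc)
open import Relation.Binary.Core using (Rel)
open import Relation.Binary.Lattice.Definitions using (Supremum)
open import Relation.Binary.PropositionalEquality.Core using (_≡_)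
open import Relation.Binary.Structures using (IsStrictPartialOrder)
open import Relation.Nullary.Negation.Core using (¬_)

-- Times and positions on the line are elements of an arbitrary ordered field,
-- the real line being the intended case.  The axioms amount to those of the
-- HoTT Book, Definition 11.2.7: no decidability of _<_ is assumed, so that
-- they hold for constructive as well as classical real numbers, and for ℚ.
-- Cotransitivity of _<_ and antisymmetry of _≤_ follow from the laws of _#_,
-- and the infimum of x and y is - (- x ⊔ - y).

record OrderedField (c ℓ₁ ℓ₂ ℓ₃ : Level) : Set (lsuc (c ⊔ˡ ℓ₁ ⊔ˡ ℓ₂ ⊔ˡ ℓ₃)) where
  infix  4 _<_ _≤_
  infixl 6 _⊔_
  field
    heytingField : HeytingField c ℓ₁ ℓ₂

  open HeytingField heytingField public

  field
    _<_                    : Rel Carrier ℓ₃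
    _⊔_                    : Op₂ Carrier
    <-isStrictPartialOrder : IsStrictPartialOrder _≈_ _<_
    #⇔<⊎>                  : ∀ {x y} → (x # y) ⇔ (x < y ⊎ y < x)
    0<1                    : 0# < 1#
    +-monoʳ-<              : ∀ z {x y} → x < y → z + x < z + y
    *-pos                  : ∀ {x y} → 0# < x → 0# < y → 0# < x * y

  _≤_ : Rel Carrier ℓ₃
  x ≤ y = ¬ (y < x)

  field
    ⊔-supremum : Supremum _≤_ _⊔_

  +-rawMonoid : RawMonoid c ℓ₁
  +-rawMonoid = record { _≈_ = _≈_ ; _∙_ = _+_ ; ε = 0# }

  open MonoidDefinitions +-rawMonoid public using (sum) renaming (_×_ to _·_)

  fromℕ : ℕ → Carrier
  fromℕ n = n · 1#

record Tape : Set where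
  field
    files         : ℕ
    size          : Vector ℕ files
    size-positive : ∀ i → NonZero (size i)

sumBefore : ∀ {n} → Vector ℕ n → Fin n → ℕ
sumBefore s zero    = 0
sumBefore s (suc i) = head s ℕ.+ sumBefore (tail s) i

module _ (T : Tape) where
  open Tape T

  leftPos : Fin files → ℕ
  leftPos = sumBefore size

  rightPos : Fin files → ℕ
  rightPos i = leftPos i ℕ.+ size i

  tapeLength : ℕ
  tapeLength = foldr ℕ._+_ 0 size

module LTS {c ℓ₁ ℓ₂ ℓ₃} (K : OrderedField c ℓ₁ ℓ₂ ℓ₃) where
  open OrderedField K

  record Request (T : Tape) : Set c where
    field
      file    : Fin (Tape.files T)
      release : Carrier

  open Request public

  record RequestSequence (T : Tape) : Set (c ⊔ˡ ℓ₃) where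
    field
      requests     : List (Request T)
      non-negative : All (λ q → 0# ≤ release q) requests
      ordered      : Linked (λ q q′ → release q ≤ release q′) requests

  open RequestSequence public

  -- A head movement gives the position of the head at each time; only its
  -- values at times t ≥ 0 are meaningful.
  record IsMovement (T : Tape) (h : Carrier → Carrier) : Set (c ⊔ˡ ℓ₁ ⊔ˡ ℓ₃) where
    field
      start : h 0# ≈ fromℕ (tapeLength T)
      speed : ∀ {s t} → 0# ≤ s → s ≤ t →
              (h t - h s ≤ t - s) × (h s - h t ≤ t - s)

  -- Strict monotonicity makes t the moment at which the head leaves the left
  -- end of the file: waiting there is not part of the reading.
  ReadingStartsAt : (T : Tape) → (Carrier → Carrier) → Fin (Tape.files T) →
                    Carrier → Set (c ⊔ˡ ℓ₁ ⊔ˡ ℓ₃)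
  ReadingStartsAt T h i t =
    h t ≈ fromℕ (leftPos T i) ×
    ∃ λ e → t < e × h e ≈ fromℕ (rightPos T i) ×
            (∀ {u v} → t ≤ u → u < v → v ≤ e → h u < h v)

  -- A request is serviced by the first reading of its file that starts at or
  -- after its release.
  ServicedAt : (T : Tape) → (Carrier → Carrier) → Request T →
               Carrier → Set (c ⊔ˡ ℓ₁ ⊔ˡ ℓ₃)
  ServicedAt T h q t =
    release q ≤ t ×
    ReadingStartsAt T h (file q) t ×
    (∀ t′ → release q ≤ t′ → ReadingStartsAt T h (file q) t′ → t ≤ t′)

  -- This holds for no x when some request is never serviced.
  TotalResponse : (T : Tape) → RequestSequence T → (Carrier → Carrier) →
                  Carrier → Set (c ⊔ˡ ℓ₁ ⊔ˡ ℓ₃)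
  TotalResponse T σ h x =
    ∃ λ (t : Vector Carrier (length (requests σ))) →
      (∀ k → ServicedAt T h (lookup (requests σ) k) (t k)) ×
      x ≈ sum (λ k → t k - release (lookup (requests σ) k))

  -- The total of a movement that leaves a request unserviced is infinite, and
  -- so exceeds every x.
  TotalResponseExceeds : (T : Tape) → RequestSequence T → (Carrier → Carrier) →
                         Carrier → Set (c ⊔ˡ ℓ₁ ⊔ˡ ℓ₃)
  TotalResponseExceeds T σ h x = ∀ y → TotalResponse T σ h y → x < y

  IsOfflineOptimum : (T : Tape) → RequestSequence T → Carrier →
                     Set (c ⊔ˡ ℓ₁ ⊔ˡ ℓ₃)
  IsOfflineOptimum T σ x =
    (∃ λ h → IsMovement T h × TotalResponse T σ h x) ×
    (∀ h y → IsMovement T h → TotalResponse T σ h y → x ≤ y)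

  -- The same requests have been released up to and including time t.
  AgreeUpTo : {T : Tape} → Carrier → RequestSequence T → RequestSequence T →
              Set (c ⊔ˡ ℓ₃)
  AgreeUpTo t σ τ =
    ∃ λ known → ∃₂ λ later later′ →
      requests σ ≡ known ++ later  × All (λ q → t < release q) later ×
      requests τ ≡ known ++ later′ × All (λ q → t < release q) later′

  -- The tape is known from the start, the requests only once released.
  record OnlinePolicy : Set (c ⊔ˡ ℓ₁ ⊔ˡ ℓ₃) where
    field
      move     : (T : Tape) → RequestSequence T → Carrier → Carrier
      movement : ∀ T σ → IsMovement T (move T σ)
      causal   : ∀ T σ τ t → 0# ≤ t → AgreeUpTo t σ τ →
                 move T σ t ≈ move T τ t

  Bounded : ((T : Tape) → RequestSequence T → Carrier) → Set (c ⊔ˡ ℓ₃)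
  Bounded f = ∃ λ B → ∀ T σ → (- B ≤ f T σ) × (f T σ ≤ B)

{-# OPTIONS --safe #-}

-- An adversary can make the offline optimum 0 while every policy pays a
-- positive amount, so no factor f helps.  Before any release the head of the
-- policy is away from one of two sufficiently distant files.  A single request
-- for that file, released before the head can get there, costs the policy
-- something, whereas the offline movement is already waiting at the file.

module Submission where

open import Defs
open import Algebra.Apartness.Bundles using (module HeytingCommutativeRing)
open import Algebra.Bundles using (module CommutativeRing)
import Algebra.Properties.AbelianGroup as AbelianGroupProperties
import Algebra.Properties.Monoid.Mult as Mult
open import Data.Fin.Base using (Fin; zero; suc)
open import Data.List.Base using ([]; _∷_)
open import Data.List.Relation.Unary.All using ([]; _∷_)
open import Data.List.Relation.Unary.Linked using ([]; [-])
open import Data.Nat.Base as ℕ using (ℕ; zero; suc; NonZero; z≤n; s≤s)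
import Data.Nat.Properties as ℕ
open import Data.Product.Base using (∃; _×_; _,_; proj₁; proj₂)
open import Data.Sum.Base using (_⊎_; inj₁; inj₂; map₂; [_,_]′)
open import Data.Vec.Functional as Vector using (Vector; foldr)
open import Function.Base using (_∘_)
open import Function.Bundles using (module Equivalence)
open import Level using () renaming (_⊔_ to _⊔ˡ_)
open import Relation.Binary.Definitions using (Cotransitive; Transitive; Antisymmetric)
import Relation.Binary.PropositionalEquality.Core as ≡
import Relation.Binary.Reasoning.Base.Triple as Triple
open import Relation.Binary.Structures using (IsStrictPartialOrder; IsPreorder)
open import Relation.Nullary.Negation.Core using (contradiction)

sumBefore≤sum : ∀ {n} (s : Vector ℕ n) i → sumBefore s i ℕ.≤ foldr ℕ._+_ 0 s
sumBefore≤sum s zero    = z≤n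
sumBefore≤sum s (suc i) = ℕ.+-monoʳ-≤ (s zero) (sumBefore≤sum (s ∘ suc) i)

-- Order properties without decidability of `_<_`.

module OrderedFieldProperties {c ℓ₁ ℓ₂ ℓ₃} (K : OrderedField c ℓ₁ ℓ₂ ℓ₃) where
  open OrderedField K hiding (zero)
  open CommutativeRing (HeytingCommutativeRing.commutativeRing heytingCommutativeRing)
    using (+-abelianGroup; +-monoid)
  open AbelianGroupProperties +-abelianGroup
    using (\\-leftDividesʳ; //-rightDividesˡ; //-rightDividesʳ)
  open IsStrictPartialOrder <-isStrictPartialOrder
    using (<-resp-≈)
    renaming (irrefl to <-irrefl; trans to <-trans; asym to <-asym)

  <-cotrans : Cotransitive _<_
  <-cotrans {x} {y} x<y z with #-cotrans (Equivalence.from #⇔<⊎> (inj₁ x<y)) z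
  ... | inj₁ x#z = map₂ (λ z<x → <-trans z<x x<y) (Equivalence.to #⇔<⊎> x#z)
  ... | inj₂ z#y with Equivalence.to #⇔<⊎> z#y
  ...   | inj₁ z<y = inj₂ z<y
  ...   | inj₂ y<z = inj₁ (<-trans x<y y<z)

  ≤-trans : Transitive _≤_
  ≤-trans {j = y} x≤y y≤z z<x = [ y≤z , x≤y ]′ (<-cotrans z<x y)

  -- Tightness reduces equality to refuting apartness, and each direction of apartness contradicts
  -- one of the hypotheses.
  ≤-antisym : Antisymmetric _≈_ _≤_
  ≤-antisym {x} {y} x≤y y≤x =
    proj₁ (tight x y) (λ x#y → [ y≤x , x≤y ]′ (Equivalence.to #⇔<⊎> x#y))

  <⇒≤ : ∀ {x y} → x < y → x ≤ y
  <⇒≤ = <-asym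

  ≤-reflexive : ∀ {x y} → x ≈ y → x ≤ y
  ≤-reflexive x≈y = <-irrefl (sym x≈y)

  ≤-refl : ∀ {x} → x ≤ x
  ≤-refl = ≤-reflexive refl

  -- As `_≤_` is only a negation, the strict conclusion has to come from cotransitivity of the
  -- strict hypothesis.
  <-≤-trans : ∀ {x y z} → x < y → y ≤ z → x < z
  <-≤-trans {z = z} x<y y≤z with <-cotrans x<y z
  ... | inj₁ x<z = x<z
  ... | inj₂ z<y = contradiction z<y y≤z

  ≤-<-trans : ∀ {x y z} → x ≤ y → y < z → x < z
  ≤-<-trans {x} x≤y y<z with <-cotrans y<z x
  ... | inj₁ y<x = contradiction y<x x≤y
  ... | inj₂ x<z = x<z

  ≤-isPreorder : IsPreorder _≈_ _≤_
  ≤-isPreorder = record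
    { isEquivalence = isEquivalence ; reflexive = ≤-reflexive ; trans = ≤-trans }

  module ≤-Reasoning = Triple ≤-isPreorder <-asym <-trans <-resp-≈ <⇒≤ <-≤-trans ≤-<-trans
  open ≤-Reasoning

  x≤x⊔y : ∀ x y → x ≤ x ⊔ y
  x≤x⊔y x y = proj₁ (⊔-supremum x y)

  y≤x⊔y : ∀ x y → y ≤ x ⊔ y
  y≤x⊔y x y = proj₁ (proj₂ (⊔-supremum x y))

  ⊔-least : ∀ {x y z} → x ≤ z → y ≤ z → x ⊔ y ≤ z
  ⊔-least {x} {y} {z} = proj₂ (proj₂ (⊔-supremum x y)) z

  x≤y⇒x⊔y≈y : ∀ {x y} → x ≤ y → x ⊔ y ≈ y
  x≤y⇒x⊔y≈y {x} {y} x≤y = ≤-antisym (⊔-least x≤y ≤-refl) (y≤x⊔y x y)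

  y≤x⇒x⊔y≈x : ∀ {x y} → y ≤ x → x ⊔ y ≈ x
  y≤x⇒x⊔y≈x {x} {y} y≤x = ≤-antisym (⊔-least ≤-refl y≤x) (x≤x⊔y x y)

  +-monoˡ-< : ∀ z {x y} → x < y → x + z < y + z
  +-monoˡ-< z {x} {y} x<y = begin-strict
    x + z  ≈⟨ +-comm x z ⟩
    z + x  <⟨ +-monoʳ-< z x<y ⟩
    z + y  ≈⟨ +-comm z y ⟩
    y + z  ∎

  +-monoʳ-≤ : ∀ z {x y} → x ≤ y → z + x ≤ z + y
  +-monoʳ-≤ z {x} {y} x≤y z+y<z+x = x≤y (begin-strict
    y              ≈⟨ \\-leftDividesʳ z y ⟨
    - z + (z + y)  <⟨ +-monoʳ-< (- z) z+y<z+x ⟩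
    - z + (z + x)  ≈⟨ \\-leftDividesʳ z x ⟩
    x              ∎)

  +-monoˡ-≤ : ∀ z {x y} → x ≤ y → x + z ≤ y + z
  +-monoˡ-≤ z {x} {y} x≤y = begin
    x + z  ≈⟨ +-comm x z ⟩
    z + x  ≤⟨ +-monoʳ-≤ z x≤y ⟩
    z + y  ≈⟨ +-comm z y ⟩
    y + z  ∎

  0≤x⇒y≤x+y : ∀ {x} y → 0# ≤ x → y ≤ x + y
  0≤x⇒y≤x+y {x} y 0≤x = begin
    y       ≈⟨ +-identityˡ y ⟨
    0# + y  ≤⟨ +-monoˡ-≤ y 0≤x ⟩
    x + y   ∎

  0<x⇒y<x+y : ∀ {x} y → 0# < x → y < x + y
  0<x⇒y<x+y {x} y 0<x = begin-strict
    y       ≈⟨ +-identityˡ y ⟨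
    0# + y  <⟨ +-monoˡ-< y 0<x ⟩
    x + y   ∎

  x<y⇒0<y-x : ∀ {x y} → x < y → 0# < y - x
  x<y⇒0<y-x {x} {y} x<y = begin-strict
    0#     ≈⟨ -‿inverseʳ x ⟨
    x - x  <⟨ +-monoˡ-< (- x) x<y ⟩
    y - x  ∎

  x≤y⇒0≤y-x : ∀ {x y} → x ≤ y → 0# ≤ y - x
  x≤y⇒0≤y-x {x} {y} x≤y = begin
    0#     ≈⟨ -‿inverseʳ x ⟨
    x - x  ≤⟨ +-monoˡ-≤ (- x) x≤y ⟩
    y - x  ∎

  x≤y⇒x-y≤0 : ∀ {x y} → x ≤ y → x - y ≤ 0#
  x≤y⇒x-y≤0 {x} {y} x≤y = begin
    x - y  ≤⟨ +-monoˡ-≤ (- y) x≤y ⟩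
    y - y  ≈⟨ -‿inverseʳ y ⟩
    0#     ∎

  x+y<z⇒x<z-y : ∀ {x y z} → x + y < z → x < z - y
  x+y<z⇒x<z-y {x} {y} {z} x+y<z = begin-strict
    x            ≈⟨ //-rightDividesʳ y x ⟨
    (x + y) - y  <⟨ +-monoˡ-< (- y) x+y<z ⟩
    z - y        ∎

  x<z-y⇒x+y<z : ∀ {x y z} → x < z - y → x + y < z
  x<z-y⇒x+y<z {x} {y} {z} x<z-y = begin-strict
    x + y        <⟨ +-monoˡ-< y x<z-y ⟩
    (z - y) + y  ≈⟨ //-rightDividesˡ y z ⟩
    z            ∎

  x≤z+y⇒x-y≤z : ∀ {x y z} → x ≤ z + y → x - y ≤ z
  x≤z+y⇒x-y≤z {x} {y} {z} x≤z+y = begin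
    x - y        ≤⟨ +-monoˡ-≤ (- y) x≤z+y ⟩
    (z + y) - y  ≈⟨ //-rightDividesʳ y z ⟩
    z            ∎

  telescope : ∀ x y z → (x - y) + (y - z) ≈ x - z
  telescope x y z = begin-equality
    (x - y) + (y - z)  ≈⟨ +-assoc (x - y) y (- z) ⟨
    ((x - y) + y) - z  ≈⟨ +-congʳ (//-rightDividesˡ y x) ⟩
    x - z              ∎

  0≤fromℕ : ∀ n → 0# ≤ fromℕ n
  0≤fromℕ zero    = ≤-refl
  0≤fromℕ (suc n) = ≤-trans (0≤fromℕ n) (0≤x⇒y≤x+y (fromℕ n) (<⇒≤ 0<1))

  0<fromℕ : ∀ n → .{{NonZero n}} → 0# < fromℕ n
  0<fromℕ (suc n) = ≤-<-trans (0≤fromℕ n) (0<x⇒y<x+y (fromℕ n) 0<1)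

  fromℕ-mono-≤ : ∀ {m n} → m ℕ.≤ n → fromℕ m ≤ fromℕ n
  fromℕ-mono-≤ {n = n} z≤n = 0≤fromℕ n
  fromℕ-mono-≤ (s≤s m≤n)   = +-monoʳ-≤ 1# (fromℕ-mono-≤ m≤n)

  fromℕ-homo-+ : ∀ m n → fromℕ (m ℕ.+ n) ≈ fromℕ m + fromℕ n
  fromℕ-homo-+ = Mult.×-homo-+ +-monoid 1#

  -- Functions of at most unit speed.

  Slow : (Carrier → Carrier) → Set (c ⊔ˡ ℓ₃)
  Slow f = ∀ {s t} → s ≤ t → f t ≤ (t - s) + f s × f s ≤ (t - s) + f t

  slow-const : ∀ x → Slow (λ _ → x)
  slow-const x s≤t = 0≤x⇒y≤x+y x (x≤y⇒0≤y-x s≤t) , 0≤x⇒y≤x+y x (x≤y⇒0≤y-x s≤t)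

  slow-left : ∀ x → Slow (λ t → x - t)
  slow-left x {s} {t} s≤t = (begin
    x - t                      ≤⟨ 0≤x⇒y≤x+y (x - t) 0≤t-s ⟩
    (t - s) + (x - t)          ≈⟨ +-comm (t - s) (x - t) ⟩
    (x - t) + (t - s)          ≈⟨ telescope x t s ⟩
    x - s                      ≤⟨ 0≤x⇒y≤x+y (x - s) 0≤t-s ⟩
    (t - s) + (x - s)          ∎) , (begin
    x - s                      ≈⟨ telescope x t s ⟨
    (x - t) + (t - s)          ≈⟨ +-comm (x - t) (t - s) ⟩
    (t - s) + (x - t)          ∎)
    where
    0≤t-s : 0# ≤ t - s
    0≤t-s = x≤y⇒0≤y-x s≤t

  slow-right : ∀ x → Slow (λ t → t - x)
  slow-right x {s} {t} s≤t =
    ≤-reflexive (sym (telescope t s x)) , (begin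
    s - x              ≤⟨ +-monoˡ-≤ (- x) s≤t ⟩
    t - x              ≤⟨ 0≤x⇒y≤x+y (t - x) (x≤y⇒0≤y-x s≤t) ⟩
    (t - s) + (t - x)  ∎)

  slow-+ : ∀ x {f} → Slow f → Slow (λ t → x + f t)
  slow-+ x {f} slow {s} {t} s≤t = shift (proj₁ (slow s≤t)) , shift (proj₂ (slow s≤t))
    where
    shift : ∀ {y z} → y ≤ (t - s) + z → x + y ≤ (t - s) + (x + z)
    shift {y} {z} y≤ = begin
      x + y              ≤⟨ +-monoʳ-≤ x y≤ ⟩
      x + ((t - s) + z)  ≈⟨ +-assoc x (t - s) z ⟨
      (x + (t - s)) + z  ≈⟨ +-congʳ (+-comm x (t - s)) ⟩
      ((t - s) + x) + z  ≈⟨ +-assoc (t - s) x z ⟩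
      (t - s) + (x + z)  ∎

  -- With differences moved to the right, as in `Slow`, both bounds lie below the bound for the
  -- join, so `⊔-least` suffices. A movement can thus be a join of simple pieces, with no case
  -- distinction on time.
  slow-⊔ : ∀ {f g} → Slow f → Slow g → Slow (λ t → f t ⊔ g t)
  slow-⊔ {f} {g} slowᶠ slowᵍ s≤t =
    join (proj₁ (slowᶠ s≤t)) (proj₁ (slowᵍ s≤t)) ,
    join (proj₂ (slowᶠ s≤t)) (proj₂ (slowᵍ s≤t))
    where
    join : ∀ {d x y x′ y′} → x ≤ d + x′ → y ≤ d + y′ → x ⊔ y ≤ d + (x′ ⊔ y′)
    join {d} {x′ = x′} {y′} x≤ y≤ =
      ⊔-least (≤-trans x≤ (+-monoʳ-≤ d (x≤x⊔y x′ y′)))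
              (≤-trans y≤ (+-monoʳ-≤ d (y≤x⊔y x′ y′)))

-- Instances with a single request.

module SingleRequest {c ℓ₁ ℓ₂ ℓ₃} (K : OrderedField c ℓ₁ ℓ₂ ℓ₃) where
  open OrderedField K hiding (zero)
  open OrderedFieldProperties K
  open ≤-Reasoning
  open LTS K
  open AbelianGroupProperties
    (CommutativeRing.+-abelianGroup
      (HeytingCommutativeRing.commutativeRing heytingCommutativeRing))
    using (//-rightDividesʳ)

  none : ∀ {T} → RequestSequence T
  none = record { requests = [] ; non-negative = [] ; ordered = [] }

  single : ∀ {T} (q : Request T) → 0# ≤ release q → RequestSequence T
  single q 0≤r = record
    { requests = q ∷ [] ; non-negative = 0≤r ∷ [] ; ordered = [-] }

  module _ {T : Tape} (q : Request T) (0≤r : 0# ≤ release q) where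

    totalResponse⁺ : ∀ {h t y} → ServicedAt T h q t → y ≈ t - release q →
                     TotalResponse T (single q 0≤r) h y
    totalResponse⁺ {t = t} serviced y≈ =
      (λ _ → t) , (λ { zero → serviced }) , trans y≈ (sym (+-identityʳ (t - release q)))

    totalResponse⁻ : ∀ {h y} → TotalResponse T (single q 0≤r) h y →
                     ∃ λ t → ServicedAt T h q t × y ≈ t - release q
    totalResponse⁻ (t , serviced , y≈) =
      t zero , serviced zero , trans y≈ (+-identityʳ (t zero - release q))

    -- Input for causality: until the release, the policy must move as it does when no request ever
    -- comes.
    none-agrees : ∀ {s} → s < release q → AgreeUpTo s (none {T}) (single q 0≤r)
    none-agrees s<r = [] , [] , q ∷ [] , ≡.refl , [] , ≡.refl , s<r ∷ []

  -- The offline optimum of a single late request.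

  module _ (T : Tape) (i : Fin (Tape.files T)) (r : Carrier)
           (0≤r : 0# ≤ r) (L≤r : fromℕ (tapeLength T) ≤ r) where
    private
      L ℓ : Carrier
      L = fromℕ (tapeLength T)
      ℓ = fromℕ (leftPos T i)

      0≤ℓ : 0# ≤ ℓ
      0≤ℓ = 0≤fromℕ (leftPos T i)

      ℓ≤L : ℓ ≤ L
      ℓ≤L = fromℕ-mono-≤ (sumBefore≤sum (Tape.size T) i)

      q : Request T
      q = record { file = i ; release = r }

    -- Go left to the file, wait there until time r, then go right.
    waitAt : Carrier → Carrier
    waitAt t = ((L - t) ⊔ ℓ) ⊔ (ℓ + (t - r))

    -- The leftward piece has fallen to at most 0 by time `L`, hence by `r`, and the constant piece
    -- `ℓ` is overtaken by the rightward one at `r`.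
    waitAt-after : ∀ {t} → r ≤ t → waitAt t ≈ ℓ + (t - r)
    waitAt-after {t} r≤t = x≤y⇒x⊔y≈y (⊔-least (≤-trans L-t≤ℓ ℓ≤) ℓ≤)
      where
      L-t≤ℓ : L - t ≤ ℓ
      L-t≤ℓ = ≤-trans (x≤y⇒x-y≤0 (≤-trans L≤r r≤t)) 0≤ℓ

      ℓ≤ : ℓ ≤ ℓ + (t - r)
      ℓ≤ = begin
        ℓ            ≈⟨ +-identityʳ ℓ ⟨
        ℓ + 0#       ≤⟨ +-monoʳ-≤ ℓ (x≤y⇒0≤y-x r≤t) ⟩
        ℓ + (t - r)  ∎

    -- At time 0 the leftward piece dominates, because `ℓ ≤ L` and `0# ≤ r`.
    waitAt-start : waitAt 0# ≈ L
    waitAt-start = begin-equality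
      waitAt 0#     ≈⟨ y≤x⇒x⊔y≈x (≤-trans ℓ-r≤ℓ (y≤x⊔y (L - 0#) ℓ)) ⟩
      (L - 0#) ⊔ ℓ  ≈⟨ y≤x⇒x⊔y≈x (≤-trans ℓ≤L (≤-reflexive (sym L-0≈L))) ⟩
      L - 0#        ≈⟨ L-0≈L ⟩
      L             ∎
      where
      L-0≈L : L - 0# ≈ L
      L-0≈L = begin-equality
        L - 0#         ≈⟨ +-congʳ (+-identityʳ L) ⟨
        (L + 0#) - 0#  ≈⟨ //-rightDividesʳ 0# L ⟩
        L              ∎

      ℓ-r≤ℓ : ℓ + (0# - r) ≤ ℓ
      ℓ-r≤ℓ = begin
        ℓ + (0# - r)  ≤⟨ +-monoʳ-≤ ℓ (x≤y⇒x-y≤0 0≤r) ⟩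
        ℓ + 0#        ≈⟨ +-identityʳ ℓ ⟩
        ℓ             ∎

    waitAt-isMovement : IsMovement T waitAt
    waitAt-isMovement = record
      { start = waitAt-start
      ; speed = λ _ s≤t → x≤z+y⇒x-y≤z (proj₁ (slow s≤t)) , x≤z+y⇒x-y≤z (proj₂ (slow s≤t))
      }
      where
      slow : Slow waitAt
      slow = slow-⊔ (slow-⊔ (slow-left L) (slow-const ℓ)) (slow-+ ℓ (slow-right r))

    waitAt-reads : ReadingStartsAt T waitAt i r
    waitAt-reads =
      (begin-equality
        waitAt r     ≈⟨ waitAt-after ≤-refl ⟩
        ℓ + (r - r)  ≈⟨ +-congˡ (-‿inverseʳ r) ⟩
        ℓ + 0#       ≈⟨ +-identityʳ ℓ ⟩
        ℓ            ∎) ,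
      -- Moving right at unit speed from time `r`, the head needs exactly the file size `s` to reach
      -- the right end.
      fromℕ s + r , r<e ,
      (begin-equality
        waitAt (fromℕ s + r)       ≈⟨ waitAt-after (<⇒≤ r<e) ⟩
        ℓ + ((fromℕ s + r) - r)    ≈⟨ +-congˡ (//-rightDividesʳ r (fromℕ s)) ⟩
        ℓ + fromℕ s                ≈⟨ fromℕ-homo-+ (leftPos T i) s ⟨
        fromℕ (rightPos T i)       ∎) ,
      λ {u} {v} r≤u u<v _ → begin-strict
        waitAt u     ≈⟨ waitAt-after r≤u ⟩
        ℓ + (u - r)  <⟨ +-monoʳ-< ℓ (+-monoˡ-< (- r) u<v) ⟩
        ℓ + (v - r)  ≈⟨ waitAt-after (≤-trans r≤u (<⇒≤ u<v)) ⟨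
        waitAt v     ∎
      where
      s : ℕ
      s = Tape.size T i

      r<e : r < fromℕ s + r
      r<e = 0<x⇒y<x+y r (0<fromℕ s {{Tape.size-positive T i}})

    -- The waiting head starts reading at the release itself and pays 0; no movement pays less,
    -- since service never precedes release.
    single-optimum : IsOfflineOptimum T (single q 0≤r) 0#
    single-optimum =
      (waitAt , waitAt-isMovement ,
       totalResponse⁺ q 0≤r waitAt-services (sym (-‿inverseʳ r))) ,
      λ h y _ total → let t , (r≤t , _) , y≈ = totalResponse⁻ q 0≤r total in begin
        0#     ≤⟨ x≤y⇒0≤y-x r≤t ⟩
        t - r  ≈⟨ y≈ ⟨
        y      ∎
      where
      waitAt-services : ServicedAt T waitAt q r
      waitAt-services = ≤-refl , waitAt-reads , λ _ r≤t _ → r≤t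

  -- The cost of a surprise request to an online policy.

  module _ (P : OnlinePolicy) {T : Tape} (i : Fin (Tape.files T)) {s d : Carrier}
           (0≤s : 0# ≤ s) (0<d : 0# < d) (0≤r : 0# ≤ d + s) where
    open OnlinePolicy P
    private
      q : Request T
      q = record { file = i ; release = d + s }

      -- The position `p` is taken on the empty sequence, so that the requested file can be chosen
      -- from it without circularity.
      p ℓ : Carrier
      p = move T none s
      ℓ = fromℕ (leftPos T i)

      h : Carrier → Carrier
      h = move T (single q 0≤r)

      p≈hs : p ≈ h s
      p≈hs = causal T none (single q 0≤r) s 0≤s (none-agrees q 0≤r (0<x⇒y<x+y s 0<d))

    -- By causality the head is still at `p` at time `s`. Covering a distance greater than `d` at
    -- unit speed takes longer than `d`, so any service starts strictly after the release `d + s`.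
    distant⇒exceeds : d < p - ℓ ⊎ d < ℓ - p → TotalResponseExceeds T (single q 0≤r) h 0#
    distant⇒exceeds far y total
      with t , (r≤t , (ht≈ℓ , _) , _) , y≈ ← totalResponse⁻ q 0≤r total = begin-strict
        0#           <⟨ x<y⇒0<y-x (x<z-y⇒x+y<z (d<t-s far)) ⟩
        t - (d + s)  ≈⟨ y≈ ⟨
        y            ∎
      where
      s≤t : s ≤ t
      s≤t = ≤-trans (0≤x⇒y≤x+y s (<⇒≤ 0<d)) r≤t

      speed : (h t - h s ≤ t - s) × (h s - h t ≤ t - s)
      speed = IsMovement.speed (movement T (single q 0≤r)) 0≤s s≤t

      d<t-s : d < p - ℓ ⊎ d < ℓ - p → d < t - s
      d<t-s (inj₁ d<p-ℓ) = begin-strict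
        d          <⟨ d<p-ℓ ⟩
        p - ℓ      ≈⟨ +-cong p≈hs (-‿cong (sym ht≈ℓ)) ⟩
        h s - h t  ≤⟨ proj₂ speed ⟩
        t - s      ∎
      d<t-s (inj₂ d<ℓ-p) = begin-strict
        d          <⟨ d<ℓ-p ⟩
        ℓ - p      ≈⟨ +-cong (sym ht≈ℓ) (-‿cong p≈hs) ⟩
        h t - h s  ≤⟨ proj₁ speed ⟩
        t - s      ∎

-- The adversary on a tape with two files.

module Adversary {c ℓ₁ ℓ₂ ℓ₃} (K : OrderedField c ℓ₁ ℓ₂ ℓ₃) where
  open OrderedField K hiding (zero)
  open OrderedFieldProperties K
  open ≤-Reasoning
  open LTS K
  open SingleRequest K

  -- The left ends 0 and 3 are so far apart that no position is within distance
  -- 1 of both; the margin makes this decidable although _<_ is not.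
  twoFiles : Tape
  twoFiles = record
    { files         = 2
    ; size          = 3 Vector.∷ 1 Vector.∷ Vector.[]
    ; size-positive = λ { zero → _ ; (suc zero) → _ }
    }

  -- Cotransitivity of `1 < 2` at `p`: a head right of 1 is far from the left end 0, and a head left
  -- of 2 is far from the left end 3.
  distant-file : ∀ p → ∃ λ i →
    1# < p - fromℕ (leftPos twoFiles i) ⊎ 1# < fromℕ (leftPos twoFiles i) - p
  distant-file p with <-cotrans (0<x⇒y<x+y (fromℕ 1) 0<1) p
  ... | inj₁ 1<p = zero , inj₁ (x+y<z⇒x<z-y 1<p)
  ... | inj₂ p<2 = suc zero , inj₂ (x+y<z⇒x<z-y (+-monoʳ-< 1# p<2))

  adversary : (f : (T : Tape) → RequestSequence T → Carrier) (P : OnlinePolicy) →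
    ∃ λ (T : Tape) → ∃ λ (σ : RequestSequence T) → ∃ λ (opt : Carrier) →
      IsOfflineOptimum T σ opt ×
      TotalResponseExceeds T σ (OnlinePolicy.move P T σ) (f T σ * opt)
  adversary f P =
    -- The head is inspected one unit before the release at time 5, too late to cover a distance
    -- above 1. The release also comes after time 4, the tape length, so an offline head can already
    -- be waiting.
    let i , far = distant-file (OnlinePolicy.move P twoFiles none (fromℕ 4))
        σ       = single (record { file = i ; release = fromℕ 5 }) (0≤fromℕ 5)
    in twoFiles , σ , 0# ,
       single-optimum twoFiles i (fromℕ 5) (0≤fromℕ 5) (fromℕ-mono-≤ (ℕ.n≤1+n 4)) ,
       λ y total → begin-strict
         -- The factor multiplies an optimum of 0, so any positive response exceeds the product.
         f twoFiles σ * 0#  ≈⟨ zeroʳ (f twoFiles σ) ⟩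
         0#                 <⟨ distant⇒exceeds P i (0≤fromℕ 4) 0<1 (0≤fromℕ 5) far y total ⟩
         y                  ∎

proposition7 : ∀ {c ℓ₁ ℓ₂ ℓ₃} (K : OrderedField c ℓ₁ ℓ₂ ℓ₃) →
    let open OrderedField K
        open LTS K in
    (f : (T : Tape) → RequestSequence T → Carrier) → Bounded f →
    (P : OnlinePolicy) →
    ∃ λ (T : Tape) → ∃ λ (σ : RequestSequence T) → ∃ λ (opt : Carrier) →
      IsOfflineOptimum T σ opt ×
      TotalResponseExceeds T σ (OnlinePolicy.move P T σ) (f T σ * opt)
proposition7 K f _ P = Adversary.adversary K f P
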